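{- For every theory $\Gamma$ and every sentence $\varphi$ of $\mathcal{L}_2$: if $\Gamma\models\varphi$, then $\Gamma\vdash\varphi$, where $\vdash$ is provability in the system consisting of the rules (axiom), (barbara), (anti), (some$_1$), (some$_2$), (darii) together with the rule schema (chains).
   Context: Syntax of $\mathcal{L}_2$. Fix a set $P$ of nouns and a set $R$ of verbs. Terms: every noun $p\in P$ is a term; if $r\in R$ and $x$ is a term then $(r\ \mathsf{all}\ x)$ is a term. Sentences: $(\mathsf{all}\ x\ y)$ and $(\mathsf{some}\ x\ y)$ for terms $x,y$. A theory is a set of sentences. Semantics. A model $\mathcal{M}$ is a set $M$ (possibly empty) with $[\![p]\!]\subseteq M$ for $p\in P$ and $[\![r]\!]\subseteq M\times M$ for $r\in R$; $[\![r\ \mathsf{all}\ x]\!]=\{m\in M: m\,[\![r]\!]\,n\text{ for all }n\in[\![x]\!]\}$. $\mathcal{M}\models(\mathsf{all}\ x\ y)$ iff $[\![x]\!]\subseteq[\![y]\!]$; $\mathcal{M}\models(\mathsf{some}\ x\ y)$ iff $[\![x]\!]\cap[\![y]\!]\neq\emptyset$. $\Gamma\models\varphi$ means every model of $\Gamma$ satisfies $\varphi$. Basic rules (for all terms $x,y,z$ and verbs $r$): (axiom) infer $(\mathsf{all}\ x\ x)$ from no premises; (barbara) from $(\mathsf{all}\ x\ y)$ and $(\mathsf{all}\ y\ z)$ infer $(\mathsf{all}\ x\ z)$; (anti) from $(\mathsf{all}\ x\ y)$ infer $(\mathsf{all}\ (r\ \mathsf{all}\ y)\ (r\ \mathsf{all}\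 x))$; (some$_1$) from $(\mathsf{some}\ x\ y)$ infer $(\mathsf{some}\ x\ x)$; (some$_2$) from $(\mathsf{some}\ x\ y)$ infer $(\mathsf{some}\ y\ x)$; (darii) from $(\mathsf{some}\ x\ y)$ and $(\mathsf{all}\ y\ z)$ infer $(\mathsf{some}\ x\ z)$. Chains. For a finite sequence of verbs $\vec r=r_1,\dots,r_k$ and a term $x$, $(\vec r\ \mathsf{all}\ x)$ denotes $(r_1\ \mathsf{all}\ (r_2\ \mathsf{all}\ (\cdots(r_k\ \mathsf{all}\ x))))$, which is $x$ when $k=0$. For terms $a,b$, a chain linking $a$ to $b$ is a sequence of sentences $C=((\mathsf{all}\ a\ u_1),(\mathsf{all}\ v_1\ u_2),\dots,(\mathsf{all}\ v_i\ u_{i+1}),\dots,(\mathsf{all}\ v_m\ b))$, $m\ge0$ (just $((\mathsf{all}\ a\ b))$ if $m=0$), such that for each $1\le i\le m$ there are terms $z_i,t_i$, a verb $r$ and a sequence of verbs $\vec r$ (all depending on $i$) with either (1) $u_i=(\vec r\ \mathsf{all}\ z_i)$ and $v_i=(\vec r\ \mathsf{all}\ (r\ \mathsf{all}\ t_i))$ with $\vec r$ of even length, or (2) $u_i=(\vec r\ \mathsf{all}\ (r\ \mathsf{all}\ t_i))$ and $v_i=(\vec r\ \mathsf{all}\ z_i)$ with $\vec r$ of odd length. The terms $t_1,\dots,t_m$ are the missing link terms of $C$. For terms $x,y$, an $(x,y)$ chain system is a sequence of chains $C_1,\dots,C_l$ such that for every missing link term $t$ in every chain $C_n$ there are $m,m'<n$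 such that $C_m$ links $t$ to $x$ and $C_{m'}$ links $t$ to $y$ (if $x=y$, $m=m'$ is allowed). (chains): if $C_1,\dots,C_l$ is an $(x,y)$ chain system, some $C_m$ links $a$ to $x$ and some $C_n$ links $b$ to $y$, then from $(\mathsf{some}\ a\ b)$ together with all the sentences occurring in $C_1,\dots,C_l$ infer $(\mathsf{some}\ x\ y)$. $\Gamma\vdash\varphi$ means there is a finite proof tree with root $\varphi$ in which each node is either a leaf in $\Gamma$ or the conclusion, with its children the premises, of an instance of one of the rules. -}

module Defs where

open import Data.Fin.Base using (Fin; _<_)
open import Data.List.Base using (List; []; _∷_; foldr; length)
open import Data.List.Membership.Propositional using () renaming (_∈_ to _∈ˡ_)
open import Data.Nat.Base using (ℕ; parity)
open import Data.Parity.Base using (0ℙ; 1ℙ)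
open import Data.Product.Base using (_×_; ∃-syntax)
open import Level using (Level; suc)
open import Relation.Binary.Core using (Rel)
open import Relation.Binary.PropositionalEquality.Core using (_≡_)
open import Relation.Unary using (Pred; _∈_; _⊆_; _≬_)

private
  variable
    ℓ : Level

data Term (P R : Set ℓ) : Set ℓ where
  noun  : P → Term P R
  _all_ : R → Term P R → Term P R

data Sentence (P R : Set ℓ) : Set ℓ where
  All Some : Term P R → Term P R → Sentence P R

Theory : (P R : Set ℓ) → Set (suc ℓ)
Theory {ℓ} P R = Pred (Sentence P R) ℓ

record Model (P R : Set ℓ) : Set (suc ℓ) where
  field
    Carrier : Set ℓ
    nounᴹ   : P → Pred Carrier ℓ
    verbᴹ   : R → Rel Carrier ℓ

  ⟦_⟧ : Term P R → Pred Carrier ℓ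
  ⟦ noun p ⟧  = nounᴹ p
  ⟦ r all x ⟧ = λ m → ∀ n → n ∈ ⟦ x ⟧ → verbᴹ r m n

module _ {ℓ} {P R : Set ℓ} where

  infix 4 _⊨ᴹ_ _⊨_ _⊢_

  _⊨ᴹ_ : Model P R → Sentence P R → Set ℓ
  M ⊨ᴹ All x y  = let open Model M in ⟦ x ⟧ ⊆ ⟦ y ⟧
  M ⊨ᴹ Some x y = let open Model M in ⟦ x ⟧ ≬ ⟦ y ⟧

  _⊨_ : Theory P R → Sentence P R → Set (suc ℓ)
  Γ ⊨ φ = (M : Model P R) → (∀ ψ → ψ ∈ Γ → M ⊨ᴹ ψ) → M ⊨ᴹ φ

  _all*_ : List R → Term P R → Term P R
  rs all* x = foldr _all_ x rs

  -- MissingLink t u v: the pair (uᵢ , vᵢ) = (u , v) is admissible in a chain,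
  -- with missing link term t.
  data MissingLink (t : Term P R) : Term P R → Term P R → Set ℓ where
    even : ∀ rs r z → parity (length rs) ≡ 0ℙ →
           MissingLink t (rs all* z) (rs all* (r all t))
    odd  : ∀ rs r z → parity (length rs) ≡ 1ℙ →
           MissingLink t (rs all* (r all t)) (rs all* z)

  -- A chain linking a to b.  It carries the decompositions of the uᵢ and vᵢ,
  -- since the sentences alone need not determine the missing link terms.
  data Chain : Term P R → Term P R → Set ℓ where
    end  : ∀ a b → Chain a b
    link : ∀ a {t u v b} → MissingLink t u v → Chain v b → Chain a b

  sentences : ∀ {a b} → Chain a b → List (Sentence P R)
  sentences (end a b)            = All a b ∷ []
  sentences (link a {u = u} _ C) = All a u ∷ sentences C

  missingLinkTerms : ∀ {a b} → Chain a b → List (Term P R)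
  missingLinkTerms (end a b)            = []
  missingLinkTerms (link a {t = t} _ C) = t ∷ missingLinkTerms C

  record ChainSystem (x y : Term P R) : Set ℓ where
    field
      size          : ℕ
      source target : Fin size → Term P R
      chain         : ∀ n → Chain (source n) (target n)

    Links : Fin size → Term P R → Term P R → Set ℓ
    Links n a b = source n ≡ a × target n ≡ b

    field
      linked : ∀ n t → t ∈ˡ missingLinkTerms (chain n) →
               (∃[ m ] m < n × Links m t x) × (∃[ m′ ] m′ < n × Links m′ t y)

  data _⊢_ (Γ : Theory P R) : Sentence P R → Set ℓ where
    premise : ∀ {φ} → φ ∈ Γ → Γ ⊢ φ
    axiom   : ∀ {x} → Γ ⊢ All x x
    barbara : ∀ {x y z} → Γ ⊢ All x y → Γ ⊢ All y z → Γ ⊢ All x z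
    anti    : ∀ {x y r} → Γ ⊢ All x y → Γ ⊢ All (r all y) (r all x)
    some₁   : ∀ {x y} → Γ ⊢ Some x y → Γ ⊢ Some x x
    some₂   : ∀ {x y} → Γ ⊢ Some x y → Γ ⊢ Some y x
    darii   : ∀ {x y z} → Γ ⊢ Some x y → Γ ⊢ All y z → Γ ⊢ Some x z
    chains  : ∀ {x y a b} (S : ChainSystem x y) → let open ChainSystem S in
              ∃[ m ] Links m a x →
              ∃[ n ] Links n b y →
              Γ ⊢ Some a b →
              (∀ n ψ → ψ ∈ˡ sentences (chain n) → Γ ⊢ ψ) →
              Γ ⊢ Some x y

{-# OPTIONS --safe #-}
module Submission where

-- The proof is constructive.  Both halves use a canonical model, built from
-- a preorder ≲ on terms that is antitone under every verb and contains every
-- derivable (all a b).  Its points are pairs of terms (a , b), thought of as an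
-- individual that is both an a and a b; such a point should lie in the
-- denotation of t exactly when a ≲ t or b ≲ t.  The only obstacle is the
-- denotation of (r all t): it is cut down correctly when (t , t) is a point,
-- and otherwise z ≲ (r all t) has to hold for every z.
--
-- For the goal (all a b), the order ≲ is derivability and all pairs are points:
-- (a , a) lies in the denotation of a, so in that of b, hence (all a b) is
-- derivable.
--
-- For the goal (some x y), a pair lying below both x and y may be a point only
-- if the goal is derivable.  Hence a term t with t ≲ x and t ≲ y has to count
-- as empty, and ≲ has to satisfy z ≲ (r all t) for every z.  The least such
-- preorder is the relation _≲_ of the module ChainOrder: a derivation of
-- a ≲ b is a chain linking a to b together with, for each missing link term t,
-- derivations of t ≲ x and t ≲ y.  It is closed under anti because prefixing a
-- verb to a chain reverses it and exchanges the even and odd links.  Listing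
-- the chains of such a tree of derivations with subtrees first gives an
-- (x , y) chain system, so the rule (chains) applies whenever Γ ⊢ Some a b,
-- a ≲ x and b ≲ y (some-≲); thus every (some a b) in Γ yields a point.
--
-- Whether (t , t) is a point cannot be decided in general.  Classical reasoning
-- is recovered by replacing each proposition A of the model by (A → G) → G,
-- where G is the derivability of the goal (truth-→ and truth-←).  This is
-- harmless, as G itself is what has to be proved.

open import Defs
open import Data.Fin.Base using (Fin; inject₁; fromℕ; _<_)
open import Data.Fin.Properties using (toℕ-inject₁; toℕ-fromℕ; toℕ<n)
open import Data.Fin.Relation.Unary.Top
  using (View; view; ‵fromℕ; ‵inject₁; view-fromℕ; view-inject₁)
open import Data.List.Base using ([]; _∷_; length)
open import Data.List.Membership.Propositional using () renaming (_∈_ to _∈ˡ_)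
open import Data.List.Relation.Unary.Any using (here; there)
import Data.Nat.Base as ℕ
open import Data.Parity.Base using (_⁻¹)
open import Data.Parity.Properties using (suc-homo-⁻¹)
open import Data.Product.Base using (_×_; _,_; proj₁; proj₂; ∃-syntax; map)
open import Data.Sum.Base using (_⊎_; inj₁; inj₂; [_,_])
open import Data.Unit.Polymorphic.Base using (⊤; tt)
open import Function.Base using (_∘_; id; _$_)
open import Relation.Binary.PropositionalEquality
  using (_≡_; refl; cong; sym; trans; subst₂)
open import Relation.Unary using (_∈_)

------------------------------------------------------------------------
-- The canonical model of an order on terms

-- G is the proposition that takes the place of falsity, and Point a b says that
-- the pair (a , b) is a point of the model.  The hypothesis point says that
-- (t , t) is a point unless z ≲ (r all t) for all z and r, with falsity read as
-- G.
module Canonical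
  {ℓ} {P R : Set ℓ} (Γ : Theory P R)
  (_≲_ Point : Term P R → Term P R → Set ℓ) (G : Set ℓ)
  (⊢⇒≲     : ∀ {a b} → Γ ⊢ All a b → a ≲ b)
  (≲-trans : ∀ {a b c} → a ≲ b → b ≲ c → a ≲ c)
  (≲-anti  : ∀ {a b r} → a ≲ b → (r all b) ≲ (r all a))
  (point   : ∀ {z r t} → (z ≲ (r all t) → G) → Point t t)
  (Some⇒Point : ∀ {a b} → Some a b ∈ Γ → Point a b)
  where

  ≲-refl : ∀ {a} → a ≲ a
  ≲-refl = ⊢⇒≲ axiom

  Pt : Set ℓ
  Pt = ∃[ a ] ∃[ b ] Point a b

  -- The points that ought to lie in the denotation of t.
  _below_ : Pt → Term P R → Set ℓ
  (a , b , _) below t = a ≲ t ⊎ b ≲ t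

  below-≲ : ∀ k {s t} → k below s → s ≲ t → k below t
  below-≲ k (inj₁ p) s≲t = inj₁ (≲-trans p s≲t)
  below-≲ k (inj₂ p) s≲t = inj₂ (≲-trans p s≲t)

  -- Double negation relative to G.
  J : Set ℓ → Set ℓ
  J A = (A → G) → G

  canonical : Model P R
  canonical = record
    { Carrier = Pt
    ; nounᴹ   = λ p k → J (k below noun p)
    ; verbᴹ   = λ r k (a , b , _) → J (k below (r all a) ⊎ k below (r all b))
    }

  open Model canonical using (⟦_⟧)

  truth-→ : ∀ t k → k ∈ ⟦ t ⟧ → J (k below t)
  truth-← : ∀ t k → J (k below t) → k ∈ ⟦ t ⟧

  truth-→ (noun p)  k h   = h
  -- It may be assumed that k below (r all t) implies G; then (t , t) is a point.
  truth-→ (r all t) k h c =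
    h (t , t , point (c ∘ inj₁))
      (truth-← t _ λ c′ → c′ (inj₁ ≲-refl))
      [ c , c ]

  truth-← (noun p)  k h         = h
  truth-← (r all t) k h n n∈t c =
    h λ k-below → truth-→ t n n∈t
      [ (λ p → c (inj₁ (below-≲ k k-below (≲-anti p))))
      , (λ p → c (inj₂ (below-≲ k k-below (≲-anti p)))) ]

  canonical-⊨ : ∀ ψ → ψ ∈ Γ → canonical ⊨ᴹ ψ
  canonical-⊨ (All a b) ψ∈Γ {k} k∈a =
    truth-← b k λ c → truth-→ a k k∈a λ p →
      c (below-≲ k p (⊢⇒≲ (premise ψ∈Γ)))
  canonical-⊨ (Some a b) ψ∈Γ =
    k , truth-← a k (_$ inj₁ ≲-refl) , truth-← b k (_$ inj₂ ≲-refl)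
    where
    k : Pt
    k = a , b , Some⇒Point ψ∈Γ

------------------------------------------------------------------------
-- Appending to a finite sequence

module _ {a} {A : Set a} {n} (f : Fin n → A) (z : A) where

  -- The entry of the extended sequence, given whether its position is the last.
  at : ∀ {i : Fin (ℕ.suc n)} → View i → A
  at ‵fromℕ       = z
  at (‵inject₁ j) = f j

  snoc : Fin (ℕ.suc n) → A
  snoc i = at (view i)

  snoc-fromℕ : snoc (fromℕ n) ≡ z
  snoc-fromℕ = cong at (view-fromℕ n)

  snoc-inject₁ : ∀ j → snoc (inject₁ j) ≡ f j
  snoc-inject₁ j = cong at (view-inject₁ j)

inject₁-mono-< : ∀ {n} {i j : Fin n} → i < j → inject₁ i < inject₁ j
inject₁-mono-< {i = i} {j} =
  subst₂ ℕ._<_ (sym (toℕ-inject₁ i)) (sym (toℕ-inject₁ j))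

inject₁<fromℕ : ∀ {n} (i : Fin n) → inject₁ i < fromℕ n
inject₁<fromℕ {n} i =
  subst₂ ℕ._<_ (sym (toℕ-inject₁ i)) (sym (toℕ-fromℕ n)) (toℕ<n i)

------------------------------------------------------------------------
-- The order generated by chains

parity-∷ : ∀ {ℓ} {R : Set ℓ} (r : R) rs {p} → ℕ.parity (length rs) ≡ p →
           ℕ.parity (length (r ∷ rs)) ≡ p ⁻¹
parity-∷ r rs eq =
  trans (sym (suc-homo-⁻¹ (ℕ.suc (length rs)))) (cong _⁻¹ eq)

-- Prefixing a verb exchanges the two kinds of missing link.
anti-link : ∀ {ℓ} {P R : Set ℓ} {t u v : Term P R} r →
            MissingLink t u v → MissingLink t (r all v) (r all u)
anti-link r (even rs s z eq) = odd  (r ∷ rs) s z (parity-∷ r rs eq)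
anti-link r (odd  rs s z eq) = even (r ∷ rs) s z (parity-∷ r rs eq)

module ChainOrder {ℓ} {P R : Set ℓ} (Γ : Theory P R) (x y : Term P R) where

  infix 4 _≲_

  -- A chain from a to b with derivable sentences, each of whose missing link
  -- terms t comes with t ≲ x and t ≲ y: a chain system unfolded into a tree.
  data _≲_ : Term P R → Term P R → Set ℓ where
    end  : ∀ {a b} → Γ ⊢ All a b → a ≲ b
    link : ∀ {a b t u v} → Γ ⊢ All a u → MissingLink t u v →
           t ≲ x → t ≲ y → v ≲ b → a ≲ b

  ≲-trans : ∀ {a b c} → a ≲ b → b ≲ c → a ≲ c
  ≲-trans (end p)             (end q)             = end (barbara p q)
  ≲-trans (end p)             (link q M tx ty q′) = link (barbara p q) M tx ty q′
  ≲-trans (link p M tx ty p′) q                   = link p M tx ty (≲-trans p′ q)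

  ≲-anti : ∀ {a b r} → a ≲ b → r all b ≲ r all a
  ≲-anti         (end p)            = end (anti p)
  ≲-anti {r = r} (link p M tx ty q) =
    ≲-trans (≲-anti q) (link axiom (anti-link r M) tx ty (end (anti p)))

  ≲-empty : ∀ {t} → t ≲ x → t ≲ y → ∀ {z r} → z ≲ r all t
  ≲-empty tx ty {z} {r} = link axiom (even [] r z refl) tx ty (end axiom)

  -- The outermost chain of a derivation; the subtrees for its missing link
  -- terms are dropped.
  chainOf : ∀ {a b} → a ≲ b → Chain a b
  chainOf (end {a} {b} _)        = end a b
  chainOf (link {a} _ M tx ty q) = link a M (chainOf q)

  chainOf-⊢ : ∀ {a b} (p : a ≲ b) ψ → ψ ∈ˡ sentences (chainOf p) → Γ ⊢ ψ
  chainOf-⊢ (end p)          ψ (here refl) = p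
  chainOf-⊢ (link p _ _ _ q) ψ (here refl) = p
  chainOf-⊢ (link p _ _ _ q) ψ (there ψ∈)  = chainOf-⊢ q ψ ψ∈

  -- Chain systems all of whose sentences are derivable.
  record System : Set ℓ where
    field
      system    : ChainSystem x y
    open ChainSystem system public
    field
      derivable : ∀ n ψ → ψ ∈ˡ sentences (chain n) → Γ ⊢ ψ

    Linked : Term P R → Term P R → Set ℓ
    Linked a b = ∃[ n ] Links n a b

  open System using (Linked)

  infix 4 _⊑_

  -- T links every pair of terms that S links.
  _⊑_ : System → System → Set ℓ
  S ⊑ T = ∀ {a b} → Linked S a b → Linked T a b

  emptySystem : System
  emptySystem = record
    { system = record
      { size = 0 ; source = λ () ; target = λ () ; chain = λ () ; linked = λ () }
    ; derivable = λ ()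
    }

  -- The missing link terms of the outermost chain of p are linked in S.
  Ready : System → ∀ {a b} → a ≲ b → Set ℓ
  Ready S p = ∀ t → t ∈ˡ missingLinkTerms (chainOf p) →
              Linked S t x × Linked S t y

  -- S followed by the outermost chain of p; the other chains of p are not added.
  module Append (S : System) {a b} (p : a ≲ b) (ready : Ready S p) where
    open System S hiding (Linked)

    AnyChain : Set ℓ
    AnyChain = ∃[ c ] ∃[ d ] Chain {P = P} {R} c d

    old : Fin size → AnyChain
    old n = source n , target n , chain n

    new : AnyChain
    new = a , b , chainOf p

    chains⁺ : Fin (ℕ.suc size) → AnyChain
    chains⁺ = snoc old new

    Links⁺ : Fin (ℕ.suc size) → Term P R → Term P R → Set ℓ
    Links⁺ n c d = proj₁ (chains⁺ n) ≡ c × proj₁ (proj₂ (chains⁺ n)) ≡ d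

    keep : ∀ {c d} n → Links n c d → Links⁺ (inject₁ n) c d
    keep n l rewrite snoc-inject₁ old new n = l

    linked⁺ : ∀ {n} (v : View n) t →
              t ∈ˡ missingLinkTerms (proj₂ (proj₂ (at old new v))) →
              (∃[ m ] m < n × Links⁺ m t x) × (∃[ m ] m < n × Links⁺ m t y)
    linked⁺ ‵fromℕ t t∈ = map earlier earlier (ready t t∈)
      where
      earlier : ∀ {d} → Linked S t d → ∃[ m ] m < fromℕ size × Links⁺ m t d
      earlier (m , l) = inject₁ m , inject₁<fromℕ m , keep m l
    linked⁺ (‵inject₁ j) t t∈ = map earlier earlier (linked j t t∈)
      where
      earlier : ∀ {d} → ∃[ m ] m < j × Links m t d →
                ∃[ m ] m < inject₁ j × Links⁺ m t d
      earlier (m , m<j , l) = inject₁ m , inject₁-mono-< m<j , keep m l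

    derivable⁺ : ∀ {n} (v : View n) ψ →
                 ψ ∈ˡ sentences (proj₂ (proj₂ (at old new v))) → Γ ⊢ ψ
    derivable⁺ ‵fromℕ       = chainOf-⊢ p
    derivable⁺ (‵inject₁ j) = derivable j

    append : System
    append = record
      { system = record
        { size   = ℕ.suc size
        ; source = λ n → proj₁ (chains⁺ n)
        ; target = λ n → proj₁ (proj₂ (chains⁺ n))
        ; chain  = λ n → proj₂ (proj₂ (chains⁺ n))
        ; linked = λ n → linked⁺ (view n)
        }
      ; derivable = λ n → derivable⁺ (view n)
      }

    append-⊒ : S ⊑ append
    append-⊒ (n , l) = inject₁ n , keep n l

    append-∋ : Linked append a b
    append-∋ = fromℕ size , cong proj₁ last , cong (proj₁ ∘ proj₂) last
      where
      last : chains⁺ (fromℕ size) ≡ new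
      last = snoc-fromℕ old new

  open Append using (append; append-⊒; append-∋)

  -- A derivation p of a ≲ b can be listed at the end of a given system, subtrees
  -- before the chain that needs them: prepare adds everything but the outermost
  -- chain of p, and insert adds that one too.
  prepare : ∀ S {a b} (p : a ≲ b) → ∃[ T ] S ⊑ T × Ready T p
  insert  : ∀ S {a b} → a ≲ b → ∃[ T ] S ⊑ T × Linked T a b

  prepare S (end p) = S , id , λ t ()
  prepare S (link {t = t} _ _ tx ty q) =
    let S₁ , S⊑S₁  , t-x   = insert S tx
        S₂ , S₁⊑S₂ , t-y   = insert S₁ ty
        S₃ , S₂⊑S₃ , ready = prepare S₂ q
    in S₃ , S₂⊑S₃ ∘ S₁⊑S₂ ∘ S⊑S₁ , λ where
      _ (here refl) → S₂⊑S₃ (S₁⊑S₂ t-x) , S₂⊑S₃ t-y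
      s (there s∈)  → ready s s∈

  insert S p =
    let T , S⊑T , ready = prepare S p
    in append T p ready , append-⊒ T p ready ∘ S⊑T , append-∋ T p ready

  some-≲ : ∀ {a b} → Γ ⊢ Some a b → a ≲ x → b ≲ y → Γ ⊢ Some x y
  some-≲ ab ax by =
    let S , _   , a-x = insert emptySystem ax
        T , S⊑T , b-y = insert S by
    in chains (System.system T) (S⊑T a-x) b-y ab (System.derivable T)

------------------------------------------------------------------------
-- Completeness for the two kinds of sentences

complete-All : ∀ {ℓ} {P R : Set ℓ} (Γ : Theory P R) a b →
               Γ ⊨ All a b → Γ ⊢ All a b
complete-All Γ a b Γ⊨ =
  truth-→ b k (Γ⊨ canonical canonical-⊨ (truth-← a k (_$ inj₁ axiom))) [ id , id ]
  where
  open Canonical Γ (λ c d → Γ ⊢ All c d) (λ _ _ → ⊤) (Γ ⊢ All a b)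
    id barbara anti (λ _ → tt) (λ _ → tt)

  k : Pt
  k = a , a , tt

complete-Some : ∀ {ℓ} {P R : Set ℓ} (Γ : Theory P R) x y →
                Γ ⊨ Some x y → Γ ⊢ Some x y
complete-Some {ℓ} {P} {R} Γ x y Γ⊨ =
  let k@(_ , _ , k-point) , k∈x , k∈y = Γ⊨ canonical canonical-⊨
  in truth-→ x k k∈x λ kx → truth-→ y k k∈y λ ky → k-point kx ky
  where
  open ChainOrder Γ x y

  -- A pair may be a point if its lying below both x and y proves the goal.
  Point : Term P R → Term P R → Set ℓ
  Point a b = a ≲ x ⊎ b ≲ x → a ≲ y ⊎ b ≲ y → Γ ⊢ Some x y

  point : ∀ {z r t} → (z ≲ r all t → Γ ⊢ Some x y) → Point t t
  point c tx ty = c (≲-empty ([ id , id ] tx) ([ id , id ] ty))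

  Some⇒Point : ∀ {a b} → Some a b ∈ Γ → Point a b
  Some⇒Point ab (inj₁ ax) (inj₁ ay) = some-≲ (some₁ (premise ab)) ax ay
  Some⇒Point ab (inj₁ ax) (inj₂ by) = some-≲ (premise ab) ax by
  Some⇒Point ab (inj₂ bx) (inj₁ ay) = some-≲ (some₂ (premise ab)) bx ay
  Some⇒Point ab (inj₂ bx) (inj₂ by) = some-≲ (some₁ (some₂ (premise ab))) bx by

  open Canonical Γ _≲_ Point (Γ ⊢ Some x y)
    end ≲-trans ≲-anti point Some⇒Point

theorem2p28 : ∀ {ℓ} {P R : Set ℓ} (Γ : Theory P R) (φ : Sentence P R) → Γ ⊨ φ → Γ ⊢ φ
theorem2p28 Γ (All a b)  = complete-All Γ a b
theorem2p28 Γ (Some x y) = complete-Some Γ x y
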